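{- The simply-typed $\lambda\upsilon$-calculus is strongly normalizing: if $\Gamma\vdash t:A$ is derivable for a $\lambda\upsilon$-term $t$, then there is no infinite reduction sequence of the $\lambda\upsilon$-calculus starting from $t$.
   Context: The $\lambda\upsilon$-calculus uses De Bruijn indices $n\geq 1$. Terms $t$ and substitutions $s$ are given by $t ::= n\mid (t\ t)\mid\lambda t\mid t[s]$, $\quad s ::= t/\ \mid\ \Uparrow(s)\ \mid\ \uparrow$. Reduction is the closure under all contexts of the rules $(\lambda t)\,u\to t[u/]$; $(t\ u)[s]\to (t[s])\ (u[s])$; $(\lambda t)[s]\to\lambda(t[\Uparrow(s)])$; $1[t/]\to t$; $(n+1)[t/]\to n$; $1[\Uparrow(s)]\to 1$; $(n+1)[\Uparrow(s)]\to n[s][\uparrow]$; $n[\uparrow]\to n+1$. Simple types are built from atomic types with $\to$; environments are finite lists of types. Typing rules for terms: $\Gamma,A,\Delta\vdash n:A$ where $n=|\Gamma|+1$; from $\Gamma\vdash s\triangleright\Gamma'$ and $\Gamma'\vdash t:A$ infer $\Gamma\vdash t[s]:A$; from $\Gamma\vdash t:B\to A$ and $\Gamma\vdash u:B$ infer $\Gamma\vdash(t\ u):A$; from $B,\Gamma\vdash t:A$ infer $\Gamma\vdash\lambda t:B\to A$. Typing rules for substitutions: from $\Gamma\vdash t:A$ infer $\Gamma\vdash t/\triangleright A,\Gamma$; $A,\Gamma\vdash\uparrow\triangleright\Gamma$; from $\Gamma\vdash s\triangleright\Gamma'$ infer $A,\Gamma\vdash\Uparrow(s)\triangleright A,\Gamma'$.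 -}

module Defs where

open import Data.List.Base using (List; _∷_; _++_; length)
open import Data.Nat.Base using (ℕ; suc; NonZero)
open import Level using (Level)

private
  variable
    a : Level

------------------------------------------------------------------------
-- Syntax

infix  9 _/
infixl 8 _[_]
infixl 7 _·_
infix  6 ƛ_

mutual

  -- De Bruijn indices start at 1.
  data Term : Set where
    var  : (n : ℕ) → .{{NonZero n}} → Term
    _·_  : Term → Term → Term
    ƛ_   : Term → Term
    _[_] : Term → Subst → Term

  data Subst : Set where
    _/ : Term → Subst
    ⇑  : Subst → Subst
    ↑  : Subst

private
  variable
    n         : ℕ
    t t′ u u′ : Term
    s s′      : Subst

------------------------------------------------------------------------
-- Reduction

infix 4 _↦_ _⟶_ _⟶ₛ_

data _↦_ : Term → Term → Set where
  Beta     : (ƛ t) · u ↦ t [ u / ]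
  App      : (t · u) [ s ] ↦ (t [ s ]) · (u [ s ])
  Lambda   : (ƛ t) [ s ] ↦ ƛ (t [ ⇑ s ])
  FVar     : var 1 [ t / ] ↦ t
  RVar     : .{{_ : NonZero n}} → var (suc n) [ t / ] ↦ var n
  FVarLift : var 1 [ ⇑ s ] ↦ var 1
  RVarLift : .{{_ : NonZero n}} → var (suc n) [ ⇑ s ] ↦ var n [ s ] [ ↑ ]
  VarShift : .{{_ : NonZero n}} → var n [ ↑ ] ↦ var (suc n)

-- Contexts may pass through substitutions, so the closure of _↦_ is
-- defined simultaneously on terms and on substitutions.
mutual

  data _⟶_ : Term → Term → Set where
    root : t ↦ t′ → t ⟶ t′
    ·ˡ   : t ⟶ t′ → t · u ⟶ t′ · u
    ·ʳ   : u ⟶ u′ → t · u ⟶ t · u′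
    ƛ⟶   : t ⟶ t′ → ƛ t ⟶ ƛ t′
    []ˡ  : t ⟶ t′ → t [ s ] ⟶ t′ [ s ]
    []ʳ  : s ⟶ₛ s′ → t [ s ] ⟶ t [ s′ ]

  data _⟶ₛ_ : Subst → Subst → Set where
    /⟶ : t ⟶ t′ → t / ⟶ₛ t′ /
    ⇑⟶ : s ⟶ₛ s′ → ⇑ s ⟶ₛ ⇑ s′

------------------------------------------------------------------------
-- Simple types over an arbitrary set of atomic types

infixr 7 _⇒_

data Type (Atom : Set a) : Set a where
  atom : Atom → Type Atom
  _⇒_  : Type Atom → Type Atom → Type Atom

Env : Set a → Set a
Env Atom = List (Type Atom)

private
  variable
    Atom   : Set a
    A B    : Type Atom
    Γ Γ′ Δ : Env Atom

infix 4 _⊢_∶_ _⊢_▷_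

mutual

  data _⊢_∶_ {Atom : Set a} : Env Atom → Term → Type Atom → Set a where
    ⊢var : Γ ++ A ∷ Δ ⊢ var (suc (length Γ)) ∶ A
    ⊢[]  : Γ ⊢ s ▷ Γ′ → Γ′ ⊢ t ∶ A → Γ ⊢ t [ s ] ∶ A
    ⊢·   : Γ ⊢ t ∶ B ⇒ A → Γ ⊢ u ∶ B → Γ ⊢ t · u ∶ A
    ⊢ƛ   : B ∷ Γ ⊢ t ∶ A → Γ ⊢ ƛ t ∶ B ⇒ A

  data _⊢_▷_ {Atom : Set a} : Env Atom → Subst → Env Atom → Set a where
    ⊢/ : Γ ⊢ t ∶ A → Γ ⊢ t / ▷ A ∷ Γ
    ⊢↑ : A ∷ Γ ⊢ ↑ ▷ Γ
    ⊢⇑ : Γ ⊢ s ▷ Γ′ → A ∷ Γ ⊢ ⇑ s ▷ A ∷ Γ′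

{-# OPTIONS --safe #-}

-- Let ⟦ t ⟧ be the pure λ-term obtained by carrying out all substitutions in t.
-- If t is typable, then ⟦ t ⟧ is β-strongly normalizing (reducibility, carried
-- out directly on λυ-derivations), hence accessible for β and subterm steps.
--
-- Call t tame if u is strongly normalizing for every u / occurring in t.  A tame
-- t is strongly normalizing whenever ⟦ t ⟧ is accessible, by induction on ⟦ t ⟧
-- and then on a weight of t.  Consider the head step t ▹ t′ that pushes a
-- substitution, or contracts a β-redex if no substitution surrounds the head:
-- t′ is strongly normalizing by induction, and a step t ⟶ u is simulated by t′
-- unless it takes place in a substitution erased by the head step, which is
-- strongly normalizing by tameness, or contracts the β-redex in
-- ((ƛ a) · b) [ s ].  In the last case, u is strongly normalizing by induction,
-- because ⟦ t ⟧ has made a β-step to ⟦ u ⟧ and u is again tame.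
-- Typable terms are tame by induction on derivations.

module Submission where

open import Defs
open import Data.Empty using (⊥-elim-irr)
open import Data.List.Base using ([]; _∷_; _++_; length)
open import Data.Nat.Base
  using (ℕ; zero; suc; pred; _+_; _*_; _^_; _<_; NonZero; ≢-nonZero⁻¹; s≤s; z≤n)
open import Data.Nat.Induction using (<-wellFounded)
open import Data.Nat.Properties
  using (*-monoʳ-<; +-monoˡ-<; m≤m+n; m≤n+m; m<m+n; m^n>0;
         ≤-trans; ≤-reflexive)
open import Data.Nat.Tactic.RingSolver using (solve-∀)
open import Data.Product.Base using (_×_; _,_; ∃-syntax; proj₂)
open import Data.Unit.Base using (⊤; tt)
open import Function.Base using (flip; _∘_)
open import Induction.InfiniteDescent
  using (InfiniteDescendingSequenceFrom; descent∧acc⇒unsatisfiable)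
open import Induction.WellFounded using (Acc; acc; acc-inverse)
open import Level using (Level)
open import Relation.Binary.Construct.Closure.Transitive
  using (TransClosure; _∷_; _∷ʳ_; accessible; accessible⁻)
  renaming ([_] to single)
open import Relation.Binary.Construct.Closure.ReflexiveTransitive
  using (Star; ε; _◅_; _◅◅_; gmap)
open import Relation.Binary.PropositionalEquality
  using (_≡_; _≗_; refl; sym; trans; cong; cong₂; subst; subst₂; module ≡-Reasoning)
open import Relation.Nullary.Negation using (¬_)

-- Pure λ-terms

-- Unlike in λυ, indices start at 0.
data Pure : Set where
  ix  : ℕ → Pure
  app : Pure → Pure → Pure
  lam : Pure → Pure

private
  variable
    p p′ q q′ : Pure
    ρ         : ℕ → ℕ
    σ τ       : ℕ → Pure

infixr 5 _∷ˢ_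

_∷ˢ_ : {X : Set} → X → (ℕ → X) → ℕ → X
(x ∷ˢ f) zero    = x
(x ∷ˢ f) (suc n) = f n

liftᵣ : (ℕ → ℕ) → ℕ → ℕ
liftᵣ ρ = 0 ∷ˢ suc ∘ ρ

ren : (ℕ → ℕ) → Pure → Pure
ren ρ (ix n)    = ix (ρ n)
ren ρ (app p q) = app (ren ρ p) (ren ρ q)
ren ρ (lam p)   = lam (ren (liftᵣ ρ) p)

lift : (ℕ → Pure) → ℕ → Pure
lift σ = ix 0 ∷ˢ ren suc ∘ σ

sub : (ℕ → Pure) → Pure → Pure
sub σ (ix n)    = σ n
sub σ (app p q) = app (sub σ p) (sub σ q)
sub σ (lam p)   = lam (sub (lift σ) p)

-- Substitution lemmas

sub-cong : σ ≗ τ → sub σ ≗ sub τ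
sub-cong e (ix n)    = e n
sub-cong e (app p q) = cong₂ app (sub-cong e p) (sub-cong e q)
sub-cong e (lam p)   = cong lam (sub-cong lift-e p)
  where
  lift-e : lift _ ≗ lift _
  lift-e zero    = refl
  lift-e (suc n) = cong (ren suc) (e n)

sub-ix : σ ≗ ix → ∀ p → sub σ p ≡ p
sub-ix e (ix n)    = e n
sub-ix e (app p q) = cong₂ app (sub-ix e p) (sub-ix e q)
sub-ix e (lam p)   = cong lam (sub-ix lift-e p)
  where
  lift-e : lift _ ≗ ix
  lift-e zero    = refl
  lift-e (suc n) = cong (ren suc) (e n)

-- Here and below the composite is a parameter fixed only pointwise. Under a binder it then suffices
-- to check the lifted equation, without function extensionality.
ren-as-sub : ix ∘ ρ ≗ σ → ren ρ ≗ sub σ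
ren-as-sub e (ix n)    = e n
ren-as-sub e (app p q) = cong₂ app (ren-as-sub e p) (ren-as-sub e q)
ren-as-sub e (lam p)   = cong lam (ren-as-sub lift-e p)
  where
  lift-e : ix ∘ liftᵣ _ ≗ lift _
  lift-e zero    = refl
  lift-e (suc n) = cong (ren suc) (e n)

sub-ren : σ ∘ ρ ≗ τ → sub σ ∘ ren ρ ≗ sub τ
sub-ren e (ix n)    = e n
sub-ren e (app p q) = cong₂ app (sub-ren e p) (sub-ren e q)
sub-ren e (lam p)   = cong lam (sub-ren lift-e p)
  where
  lift-e : lift _ ∘ liftᵣ _ ≗ lift _
  lift-e zero    = refl
  lift-e (suc n) = cong (ren suc) (e n)

ren-ren : ∀ {ρ₁ ρ₂} → ρ₂ ∘ ρ₁ ≗ ρ → ren ρ₂ ∘ ren ρ₁ ≗ ren ρ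
ren-ren e (ix n)    = cong ix (e n)
ren-ren e (app p q) = cong₂ app (ren-ren e p) (ren-ren e q)
ren-ren e (lam p)   = cong lam (ren-ren lift-e p)
  where
  lift-e : liftᵣ _ ∘ liftᵣ _ ≗ liftᵣ _
  lift-e zero    = refl
  lift-e (suc n) = cong suc (e n)

ren-sub : ren ρ ∘ σ ≗ τ → ren ρ ∘ sub σ ≗ sub τ
ren-sub e (ix n)    = e n
ren-sub e (app p q) = cong₂ app (ren-sub e p) (ren-sub e q)
ren-sub {ρ} {σ} {τ} e (lam p) = cong lam (ren-sub lift-e p)
  where
  lift-e : ren (liftᵣ ρ) ∘ lift σ ≗ lift τ
  lift-e zero    = refl
  lift-e (suc n) = begin
    ren (liftᵣ ρ) (ren suc (σ n)) ≡⟨ ren-ren (λ _ → refl) (σ n) ⟩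
    ren (suc ∘ ρ) (σ n)           ≡⟨ ren-ren (λ _ → refl) (σ n) ⟨
    ren suc (ren ρ (σ n))         ≡⟨ cong (ren suc) (e n) ⟩
    ren suc (τ n)                 ∎
    where open ≡-Reasoning

sub-sub : ∀ {σ₁ σ₂} → sub σ₂ ∘ σ₁ ≗ σ → sub σ₂ ∘ sub σ₁ ≗ sub σ
sub-sub e (ix n)    = e n
sub-sub e (app p q) = cong₂ app (sub-sub e p) (sub-sub e q)
sub-sub {σ} {σ₁} {σ₂} e (lam p) = cong lam (sub-sub lift-e p)
  where
  lift-e : sub (lift σ₂) ∘ lift σ₁ ≗ lift σ
  lift-e zero    = refl
  lift-e (suc n) = begin
    sub (lift σ₂) (ren suc (σ₁ n)) ≡⟨ sub-ren (λ _ → refl) (σ₁ n) ⟩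
    sub (ren suc ∘ σ₂) (σ₁ n)      ≡⟨ ren-sub (λ _ → refl) (σ₁ n) ⟨
    ren suc (sub σ₂ (σ₁ n))        ≡⟨ cong (ren suc) (e n) ⟩
    ren suc (σ n)                  ∎
    where open ≡-Reasoning

infixl 8 _⟨_⟩

_⟨_⟩ : Pure → Pure → Pure
p ⟨ q ⟩ = sub (q ∷ˢ ix) p

sub-lift-⟨⟩ : ∀ σ p q → sub (lift σ) p ⟨ q ⟩ ≡ sub (q ∷ˢ σ) p
sub-lift-⟨⟩ σ p q = sub-sub e p
  where
  e : sub (q ∷ˢ ix) ∘ lift σ ≗ q ∷ˢ σ
  e zero    = refl
  e (suc n) = trans (sub-ren (λ _ → refl) (σ n)) (sub-ix (λ _ → refl) (σ n))

sub-⟨⟩ : ∀ σ p q → sub (lift σ) p ⟨ sub σ q ⟩ ≡ sub σ (p ⟨ q ⟩)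
sub-⟨⟩ σ p q = trans (sub-lift-⟨⟩ σ p (sub σ q)) (sym (sub-sub e p))
  where
  e : sub σ ∘ (q ∷ˢ ix) ≗ sub σ q ∷ˢ σ
  e zero    = refl
  e (suc n) = refl

-- β-reduction of pure terms

infix 4 _⟶β_ _↠_ _≺_ _≺⁺_

data _⟶β_ : Pure → Pure → Set where
  β    : app (lam p) q ⟶β p ⟨ q ⟩
  appˡ : p ⟶β p′ → app p q ⟶β app p′ q
  appʳ : q ⟶β q′ → app p q ⟶β app p q′
  lam  : p ⟶β p′ → lam p ⟶β lam p′

_↠_ : Pure → Pure → Set
_↠_ = Star _⟶β_

SNβ : Pure → Set
SNβ = Acc (flip _⟶β_)

sub-⟶β : ∀ σ → p ⟶β p′ → sub σ p ⟶β sub σ p′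
sub-⟶β σ (β {p} {q}) =
  subst (app (lam (sub (lift σ) p)) (sub σ q) ⟶β_) (sub-⟨⟩ σ p q) β
sub-⟶β σ (appˡ r)    = appˡ (sub-⟶β σ r)
sub-⟶β σ (appʳ r)    = appʳ (sub-⟶β σ r)
sub-⟶β σ (lam r)     = lam (sub-⟶β (lift σ) r)

ren-⟶β : ∀ ρ → p ⟶β p′ → ren ρ p ⟶β ren ρ p′
ren-⟶β {p} {p′} ρ r =
  subst₂ _⟶β_ (sym (ren-as-sub (λ _ → refl) p)) (sym (ren-as-sub (λ _ → refl) p′))
    (sub-⟶β (ix ∘ ρ) r)

app-↠ : p ↠ p′ → q ↠ q′ → app p q ↠ app p′ q′
app-↠ rs ss = gmap (λ p → app p _) appˡ rs ◅◅ gmap (app _) appʳ ss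

lift-↠ : (∀ n → σ n ↠ τ n) → ∀ n → lift σ n ↠ lift τ n
lift-↠ rs zero    = ε
lift-↠ rs (suc n) = gmap (ren suc) (ren-⟶β suc) (rs n)

sub-↠ : (∀ n → σ n ↠ τ n) → ∀ p → sub σ p ↠ sub τ p
sub-↠ rs (ix n)    = rs n
sub-↠ rs (app p q) = app-↠ (sub-↠ rs p) (sub-↠ rs q)
sub-↠ rs (lam p)   = gmap lam lam (sub-↠ (lift-↠ rs) p)

acc-unmap : {X Y : Set} {_<ˣ_ : X → X → Set} {_<ʸ_ : Y → Y → Set} {f : X → Y} →
            (∀ {x x′} → x′ <ˣ x → f x′ <ʸ f x) → ∀ {x} → Acc _<ʸ_ (f x) → Acc _<ˣ_ x
acc-unmap g (acc h) = acc λ r → acc-unmap g (h (g r))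

data _≺_ : Pure → Pure → Set where
  β    : p ⟶β q → q ≺ p
  appˡ : p ≺ app p q
  appʳ : q ≺ app p q
  lam  : p ≺ lam p

_≺⁺_ : Pure → Pure → Set
_≺⁺_ = TransClosure _≺_

-- A β-step of a subterm extends to one of `p`, whose reduct has the subterm's reduct below it. So
-- the hypothesis passes to subterms, and structural induction applies.
≺-acc : ∀ p → (∀ {q} → p ⟶β q → Acc _≺_ q) → Acc _≺_ p
≺-acc p h = acc λ where
  (β r) → h r
  appˡ  → ≺-acc _ λ r → acc-inverse (h (appˡ r)) appˡ
  appʳ  → ≺-acc _ λ r → acc-inverse (h (appʳ r)) appʳ
  lam   → ≺-acc _ λ r → acc-inverse (h (lam r)) lam

SNβ⇒≺-acc : SNβ p → Acc _≺_ p
SNβ⇒≺-acc (acc h) = ≺-acc _ λ r → SNβ⇒≺-acc (h r)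

↠-⟶β⇒≺⁺ : p ↠ p′ → p′ ⟶β q → q ≺⁺ p
↠-⟶β⇒≺⁺ ε        r = single (β r)
↠-⟶β⇒≺⁺ (x ◅ xs) r = ↠-⟶β⇒≺⁺ xs r ∷ʳ β x

-- Translation of λυ-terms

mutual

  ⟦_⟧ : Term → Pure
  ⟦ var n ⟧   = ix (pred n)
  ⟦ t · u ⟧   = app ⟦ t ⟧ ⟦ u ⟧
  ⟦ ƛ t ⟧     = lam ⟦ t ⟧
  ⟦ t [ s ] ⟧ = sub ⟦ s ⟧ₛ ⟦ t ⟧

  ⟦_⟧ₛ : Subst → ℕ → Pure
  ⟦ t / ⟧ₛ = ⟦ t ⟧ ∷ˢ ix
  ⟦ ⇑ s ⟧ₛ = lift ⟦ s ⟧ₛ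
  ⟦ ↑ ⟧ₛ   = ix ∘ suc

-- Reducibility

-- Girard's neutral terms: applying one creates no β-redex at the root.
data NonLam : Pure → Set where
  ix  : ∀ n → NonLam (ix n)
  app : ∀ p q → NonLam (app p q)

module _ {a : Level} {Atom : Set a} where

  private
    variable
      A B : Type Atom
      Γ Δ : Env Atom
      t   : Term
      s   : Subst

  -- Pure terms stay untyped; the type only directs the recursion.
  Red : Type Atom → Pure → Set
  Red (atom _) p = SNβ p
  Red (A ⇒ B)  p = ∀ {q} → Red A q → Red B (app p q)

  Red-⟶β : ∀ A → p ⟶β q → Red A p → Red A q
  Red-⟶β (atom _) r h = acc-inverse h r
  Red-⟶β (A ⇒ B)  r f = λ h → Red-⟶β B (appˡ r) (f h)

  mutual

    Red⇒SNβ : ∀ A → Red A p → SNβ p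
    Red⇒SNβ (atom _) h = h
    Red⇒SNβ (A ⇒ B)  f = acc-unmap appˡ (Red⇒SNβ B (f (Red-ix A 0)))

    Red-ix : ∀ A n → Red A (ix n)
    Red-ix A n = Red-NonLam A (ix n) λ ()

    -- At an arrow type, induction on the normalization of the argument: `app p q` is again neutral,
    -- and its reducts change only `p` or `q`.
    Red-NonLam : ∀ A → NonLam p → (∀ {q} → p ⟶β q → Red A q) → Red A p
    Red-NonLam         (atom _) nl h = acc h
    Red-NonLam {p = p} (A ⇒ B)  nl h = λ r → go r (Red⇒SNβ A r)
      where
      go : Red A q → SNβ q → Red B (app p q)
      go-⟶β : Red A q → SNβ q → NonLam p → app p q ⟶β p′ → Red B p′
      go r sn = Red-NonLam B (app _ _) (go-⟶β r sn nl)
      go-⟶β r _        _  (appˡ x) = h x r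
      go-⟶β r (acc sn) _  (appʳ x) = go (Red-⟶β A x r) (sn x)

  Red-lam : (∀ {q} → Red A q → Red B (p ⟨ q ⟩)) → Red (A ⇒ B) (lam p)
  Red-lam {A = A} {B = B} h r =
    -- `p` normalizes because its instance at a variable does and substitution preserves β-steps.
    go h r (acc-unmap (sub-⟶β _) (Red⇒SNβ B (h (Red-ix A 0)))) (Red⇒SNβ A r)
    where
    go : (∀ {q} → Red A q → Red B (p ⟨ q ⟩)) → Red A q → SNβ p → SNβ q →
         Red B (app (lam p) q)
    go h r (acc sp) (acc sq) = Red-NonLam B (app _ _) λ where
      β              → h r
      (appˡ (lam x)) → go (λ r′ → Red-⟶β B (sub-⟶β _ x) (h r′)) r (sp x) (acc sq)
      (appʳ x)       → go h (Red-⟶β A x r) (acc sp) (sq x)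

  -- Only the indices below the length of the environment are constrained.
  Redₑ : Env Atom → (ℕ → Pure) → Set
  Redₑ []      σ = ⊤
  Redₑ (A ∷ Γ) σ = Red A (σ 0) × Redₑ Γ (σ ∘ suc)

  Redₑ-cong : ∀ Γ → σ ≗ τ → Redₑ Γ σ → Redₑ Γ τ
  Redₑ-cong []      e _       = tt
  Redₑ-cong (A ∷ Γ) e (r , γ) = subst (Red A) (e 0) r , Redₑ-cong Γ (e ∘ suc) γ

  Redₑ-ix : ∀ Γ ρ → Redₑ Γ (ix ∘ ρ)
  Redₑ-ix []      ρ = tt
  Redₑ-ix (A ∷ Γ) ρ = Red-ix A (ρ 0) , Redₑ-ix Γ (ρ ∘ suc)

  Redₑ-lookup : ∀ Γ → Redₑ (Γ ++ A ∷ Δ) σ → Red A (σ (length Γ))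
  Redₑ-lookup []      (r , _) = r
  Redₑ-lookup (_ ∷ Γ) (_ , γ) = Redₑ-lookup Γ γ

  mutual

    -- The fundamental lemma. For a closure, the substitution's derivation turns a reducible `σ`
    -- into one for the environment of the body.
    ⊢⇒Red : Γ ⊢ t ∶ A → Redₑ Γ σ → Red A (sub σ ⟦ t ⟧)
    ⊢⇒Red (⊢var {Γ = Γ}) γ = Redₑ-lookup Γ γ
    ⊢⇒Red {A = A} (⊢[] {t = t} ⊢s ⊢t) γ =
      subst (Red A) (sym (sub-sub (λ _ → refl) ⟦ t ⟧)) (⊢⇒Red ⊢t (⊢⇒Redₑ ⊢s γ))
    ⊢⇒Red (⊢· ⊢t ⊢u) γ = ⊢⇒Red ⊢t γ (⊢⇒Red ⊢u γ)
    ⊢⇒Red {σ = σ} (⊢ƛ {B = B} {t = t} {A = A} ⊢t) γ = Red-lam λ {q} r →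
      subst (Red A) (sym (sub-lift-⟨⟩ σ ⟦ t ⟧ q)) (⊢⇒Red ⊢t (r , γ))

    ⊢⇒Redₑ : Γ ⊢ s ▷ Δ → Redₑ Γ σ → Redₑ Δ (sub σ ∘ ⟦ s ⟧ₛ)
    ⊢⇒Redₑ (⊢/ ⊢t) γ       = ⊢⇒Red ⊢t γ , γ
    ⊢⇒Redₑ ⊢↑      (_ , γ) = γ
    ⊢⇒Redₑ {σ = σ} (⊢⇑ {s = s} {Γ′ = Γ′} ⊢s) (r , γ) =
      r , Redₑ-cong Γ′ (λ n → sym (sub-ren (λ _ → refl) (⟦ s ⟧ₛ n))) (⊢⇒Redₑ ⊢s γ)

  ⊢⇒SNβ : Γ ⊢ t ∶ A → SNβ ⟦ t ⟧
  ⊢⇒SNβ {Γ = Γ} {t = t} {A = A} ⊢t =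
    subst SNβ (sub-ix (λ _ → refl) ⟦ t ⟧) (Red⇒SNβ A (⊢⇒Red ⊢t (Redₑ-ix Γ λ n → n)))

-- Head reduction of λυ-terms

private
  variable
    n           : ℕ
    t t′ u u′ v : Term
    s s′        : Subst

SN : Term → Set
SN = Acc (flip _⟶_)

SNₛ : Subst → Set
SNₛ = Acc (flip _⟶ₛ_)

infix 4 _⟶⁺_ _▹[_]_ _▹β_

_⟶⁺_ : Term → Term → Set
t ⟶⁺ u = TransClosure (flip _⟶_) u t

-- The index s of t ▹[ s ] t′ is the substitution erased by the step, or ↑ if
-- there is none.
data _▹[_]_ : Term → Subst → Term → Set where
  App      : (t · u) [ s ] ▹[ ↑ ] (t [ s ]) · (u [ s ])
  Lambda   : (ƛ t) [ s ] ▹[ ↑ ] ƛ (t [ ⇑ s ])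
  FVar     : var 1 [ t / ] ▹[ ↑ ] t
  RVar     : .{{_ : NonZero n}} → var (suc n) [ t / ] ▹[ t / ] var n
  FVarLift : var 1 [ ⇑ s ] ▹[ s ] var 1
  RVarLift : .{{_ : NonZero n}} → var (suc n) [ ⇑ s ] ▹[ ↑ ] var n [ s ] [ ↑ ]
  VarShift : .{{_ : NonZero n}} → var n [ ↑ ] ▹[ ↑ ] var (suc n)
  ·ˡ       : t ▹[ s ] t′ → t · u ▹[ s ] t′ · u
  []ˡ      : t ▹[ s ] t′ → t [ s′ ] ▹[ s ] t′ [ s′ ]

data _▹β_ : Term → Term → Set where
  Beta : (ƛ t) · u ▹β t [ u / ]
  ·ˡ   : t ▹β t′ → t · u ▹β t′ · u

-- Normalization of substitutions

▹-⟦⟧ : t ▹[ s ] t′ → ⟦ t ⟧ ≡ ⟦ t′ ⟧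
▹-⟦⟧ App                    = refl
▹-⟦⟧ Lambda                 = refl
▹-⟦⟧ FVar                   = refl
▹-⟦⟧ (RVar {suc n})         = refl
▹-⟦⟧ FVarLift               = refl
▹-⟦⟧ (RVarLift {suc n} {s}) = ren-as-sub (λ _ → refl) (⟦ s ⟧ₛ n)
▹-⟦⟧ (VarShift {suc n})     = refl
▹-⟦⟧ (·ˡ h)                 = cong (λ p → app p _) (▹-⟦⟧ h)
▹-⟦⟧ ([]ˡ h)                = cong (sub _) (▹-⟦⟧ h)

↦-⟦⟧ : t ↦ t′ → ⟦ t ⟧ ↠ ⟦ t′ ⟧
↦-⟦⟧ Beta     = β ◅ ε
↦-⟦⟧ App      = ε
↦-⟦⟧ Lambda   = ε
↦-⟦⟧ FVar     = ε
↦-⟦⟧ {t} (RVar {t = u}) = subst (⟦ t ⟧ ↠_) (▹-⟦⟧ (RVar {t = u})) ε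
↦-⟦⟧ FVarLift = ε
↦-⟦⟧ {t} (RVarLift {s = s}) = subst (⟦ t ⟧ ↠_) (▹-⟦⟧ (RVarLift {s = s})) ε
↦-⟦⟧ {t} VarShift = subst (⟦ t ⟧ ↠_) (▹-⟦⟧ VarShift) ε

mutual

  -- Any number of β-steps can result, since a step inside a substitution is copied or erased with
  -- it.
  ⟶-⟦⟧ : t ⟶ t′ → ⟦ t ⟧ ↠ ⟦ t′ ⟧
  ⟶-⟦⟧ (root r) = ↦-⟦⟧ r
  ⟶-⟦⟧ (·ˡ x)   = app-↠ (⟶-⟦⟧ x) ε
  ⟶-⟦⟧ (·ʳ x)   = app-↠ ε (⟶-⟦⟧ x)
  ⟶-⟦⟧ (ƛ⟶ x)   = gmap lam lam (⟶-⟦⟧ x)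
  ⟶-⟦⟧ ([]ˡ x)  = gmap (sub _) (sub-⟶β _) (⟶-⟦⟧ x)
  ⟶-⟦⟧ ([]ʳ {t = t} x) = sub-↠ (⟶ₛ-⟦⟧ₛ x) ⟦ t ⟧

  ⟶ₛ-⟦⟧ₛ : s ⟶ₛ s′ → ∀ n → ⟦ s ⟧ₛ n ↠ ⟦ s′ ⟧ₛ n
  ⟶ₛ-⟦⟧ₛ (/⟶ x) zero    = ⟶-⟦⟧ x
  ⟶ₛ-⟦⟧ₛ (/⟶ x) (suc n) = ε
  ⟶ₛ-⟦⟧ₛ (⇑⟶ x)         = lift-↠ (⟶ₛ-⟦⟧ₛ x)

▹β-⟦⟧ : t ▹β t′ → ⟦ t ⟧ ⟶β ⟦ t′ ⟧
▹β-⟦⟧ Beta   = β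
▹β-⟦⟧ (·ˡ h) = appˡ (▹β-⟦⟧ h)

-- Arguments and bodies of abstractions do not count, since _▹[_]_ never reduces
-- inside them.
mutual

  weight : Term → ℕ
  weight (var n)   = 2 ^ n
  weight (t · u)   = suc (weight t)
  weight (ƛ t)     = 1
  weight (t [ s ]) = 2 * weight t + weightₛ s

  weightₛ : Subst → ℕ
  weightₛ (t /) = weight t
  weightₛ (⇑ s) = 2 * weightₛ s + 2
  weightₛ ↑     = 1

-- `RVarLift` lowers an index but adds a closure, which doubles the weight: hence `2 ^ n`. The `+ 2`
-- for `⇑` exceeds the weight of the new `↑` by one.
▹-weight : t ▹[ s ] t′ → weight t′ < weight t
▹-weight (App {t} {s = s}) = ≤-reflexive (eq (weight t) (weightₛ s))
  where
  eq : ∀ x y → suc (suc (2 * x + y)) ≡ 2 * suc x + y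
  eq = solve-∀
▹-weight Lambda       = s≤s (s≤s z≤n)
▹-weight (FVar {t})   = s≤s (m≤n+m (weight t) 3)
▹-weight (RVar {n} {t}) =
  subst (2 ^ n <_) (eq (2 ^ n) (weight t))
    (m<m+n (2 ^ n) (≤-trans (m^n>0 2 n) (m≤m+n (2 ^ n) _)))
  where
  eq : ∀ x y → x + (x + (2 * x + y)) ≡ 2 * (2 * x) + y
  eq = solve-∀
▹-weight FVarLift     = s≤s (s≤s (s≤s z≤n))
▹-weight (RVarLift {n} {s}) = ≤-reflexive (eq (2 ^ n) (weightₛ s))
  where
  eq : ∀ x y → suc (2 * (2 * x + y) + 1) ≡ 2 * (2 * x) + (2 * y + 2)
  eq = solve-∀
▹-weight (VarShift {n}) = m<m+n (2 * 2 ^ n) (s≤s z≤n)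
▹-weight (·ˡ h)       = s≤s (▹-weight h)
▹-weight ([]ˡ h)      = +-monoˡ-< _ (*-monoʳ-< 2 (▹-weight h))

-- Progress of head reduction

data Neutral : Term → Set where
  var : ∀ n → .{{_ : NonZero n}} → Neutral (var n)
  _·_ : Neutral t → ∀ u → Neutral (t · u)

data Progress : Term → Set where
  υ-step  : t ▹[ s ] t′ → Progress t
  β-step  : t ▹β t′ → Progress t
  abs     : ∀ t → Progress (ƛ t)
  neutral : Neutral t → Progress t

-- Nested closures are entered until the body is not a closure; the substitution there is pushed
-- first.
push : ∀ t s → ∃[ s₁ ] ∃[ t′ ] t [ s ] ▹[ s₁ ] t′
push (var zero {{n≢0}}) s   = ⊥-elim-irr (≢-nonZero⁻¹ 0 {{n≢0}} refl)
push (var 1)             (t /) = _ , _ , FVar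
push (var (suc (suc n))) (t /) = _ , _ , RVar
push (var 1)             (⇑ s) = _ , _ , FVarLift
push (var (suc (suc n))) (⇑ s) = _ , _ , RVarLift
push (var (suc n))       ↑     = _ , _ , VarShift
push (t · u)    s = _ , _ , App
push (ƛ t)      s = _ , _ , Lambda
push (t [ s₁ ]) s with _ , _ , h ← push t s₁ = _ , _ , []ˡ h

progress : ∀ t → Progress t
progress (var n) = neutral (var n)
progress (t · u) with progress t
... | υ-step h  = υ-step (·ˡ h)
... | β-step h  = β-step (·ˡ h)
... | abs _     = β-step Beta
... | neutral n = neutral (n · u)
progress (ƛ t)     = abs t
progress (t [ s ]) = υ-step (proj₂ (proj₂ (push t s)))

-- Strong normalization of λυ-terms

SN-function : SN (t · u) → SN t
SN-function = acc-unmap ·ˡ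

SN-argument : SN (t · u) → SN u
SN-argument = acc-unmap ·ʳ

SN-body : SN (t [ s ]) → SN t
SN-body = acc-unmap []ˡ

SN-ƛ : SN t → SN (ƛ t)
SN-ƛ (acc h) = acc λ where (ƛ⟶ x) → SN-ƛ (h x)

SN-/ : SN t → SNₛ (t /)
SN-/ (acc h) = acc λ where (/⟶ x) → SN-/ (h x)

SN-⇑ : SNₛ s → SNₛ (⇑ s)
SN-⇑ (acc h) = acc λ where (⇑⟶ x) → SN-⇑ (h x)

Neutral-⟶ : Neutral t → t ⟶ t′ → Neutral t′
Neutral-⟶ (var n) (root ())
Neutral-⟶ (() · _) (root Beta)
Neutral-⟶ (m · u) (·ˡ x)         = Neutral-⟶ m x · u
Neutral-⟶ (m · _) (·ʳ {u′ = u} x) = m · u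

SN-· : Neutral t → SN t → SN u → SN (t · u)
SN-· {t} {u} m (acc h) (acc k) = acc (go m)
  where
  go : Neutral t → t · u ⟶ v → SN v
  go m (·ˡ x) = SN-· (Neutral-⟶ m x) (h x) (acc k)
  go m (·ʳ x) = SN-· m (acc h) (k x)
  go () (root Beta)

-- Tameness

mutual

  Tame : Term → Set
  Tame (var n)   = ⊤
  Tame (t · u)   = Tame t × Tame u
  Tame (ƛ t)     = Tame t
  Tame (t [ s ]) = Tame t × Tameₛ s

  Tameₛ : Subst → Set
  Tameₛ (t /) = Tame t × SN t
  Tameₛ (⇑ s) = Tameₛ s
  Tameₛ ↑     = ⊤

mutual

  SN⇒Tame : ∀ t → SN t → Tame t
  SN⇒Tame (var n)   h = tt
  SN⇒Tame (t · u)   h = SN⇒Tame t (SN-function h) , SN⇒Tame u (SN-argument h)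
  SN⇒Tame (ƛ t)     h = SN⇒Tame t (acc-unmap ƛ⟶ h)
  SN⇒Tame (t [ s ]) h = SN⇒Tame t (SN-body h) , SNₛ⇒Tameₛ s (acc-unmap []ʳ h)

  SNₛ⇒Tameₛ : ∀ s → SNₛ s → Tameₛ s
  SNₛ⇒Tameₛ (t /) h = SN⇒Tame t (acc-unmap /⟶ h) , acc-unmap /⟶ h
  SNₛ⇒Tameₛ (⇑ s) h = SNₛ⇒Tameₛ s (acc-unmap ⇑⟶ h)
  SNₛ⇒Tameₛ ↑     h = tt

Tameₛ⇒SNₛ : ∀ s → Tameₛ s → SNₛ s
Tameₛ⇒SNₛ (t /) (_ , h) = SN-/ h
Tameₛ⇒SNₛ (⇑ s) h       = SN-⇑ (Tameₛ⇒SNₛ s h)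
Tameₛ⇒SNₛ ↑     _       = acc λ ()

▹-Tame : t ▹[ s ] t′ → Tame t → Tame t′ × SNₛ s
▹-Tame App ((a , b) , c)       = ((a , c) , (b , c)) , acc λ ()
▹-Tame Lambda a                = a , acc λ ()
▹-Tame FVar (_ , a , _)        = a , acc λ ()
▹-Tame RVar (_ , _ , h)        = tt , SN-/ h
▹-Tame (FVarLift {s}) (_ , c)  = tt , Tameₛ⇒SNₛ s c
▹-Tame RVarLift (_ , c)        = ((tt , c) , tt) , acc λ ()
▹-Tame VarShift _              = tt , acc λ ()
▹-Tame (·ˡ h) (a , b)          = let a′ , sn = ▹-Tame h a in (a′ , b) , sn
▹-Tame ([]ˡ h) (a , c)         = let a′ , sn = ▹-Tame h a in (a′ , c) , sn

-- Whatever `t` contains survives in `t′` or in the erased `s`. This recovers tameness of reducts,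
-- along which it is not tracked.
▹-unTame : t ▹[ s ] t′ → SNₛ s → SN t′ → Tame t
▹-unTame (App {t} {u} {s}) _ h
  with (a , c) , (b , _) ← SN⇒Tame (t [ s ] · u [ s ]) h = (a , b) , c
▹-unTame (Lambda {t} {s}) _ h     = SN⇒Tame (ƛ (t [ ⇑ s ])) h
▹-unTame (FVar {t}) _ h           = tt , SN⇒Tame t h , h
▹-unTame (RVar {t = t}) k _       = tt , SNₛ⇒Tameₛ (t /) k
▹-unTame (FVarLift {s}) k _       = tt , SNₛ⇒Tameₛ s k
▹-unTame (RVarLift {s = s}) _ h   = tt , SNₛ⇒Tameₛ s (acc-unmap []ʳ (SN-body h))
▹-unTame VarShift _ _             = tt , tt
▹-unTame (·ˡ {u = u} r) k h       =
  ▹-unTame r k (SN-function h) , SN⇒Tame u (SN-argument h)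
▹-unTame ([]ˡ {s′ = s} r) k h     =
  ▹-unTame r k (SN-body h) , SNₛ⇒Tameₛ s (acc-unmap []ʳ h)

▹β-unTame : t ▹β t′ → SN t′ → Tame t
▹β-unTame (Beta {t} {u}) h with a , b , _ ← SN⇒Tame (t [ u / ]) h = a , b
▹β-unTame (·ˡ {u = u} r) h =
  ▹β-unTame r (SN-function h) , SN⇒Tame u (SN-argument h)

-- How a head step t to t′ erasing s answers an arbitrary step from t to u.  The
-- last alternative arises from the critical pair of Beta and App, which cannot
-- be closed by reducing t′.
data Answer (R : Subst → Term → Term → Set) (s : Subst) (t t′ u : Term) : Set where
  done   : u ≡ t′ → Answer R s t t′ u
  follow : R s u u′ → t′ ⟶⁺ u′ → Answer R s t t′ u
  erased : s ⟶ₛ s′ → R s′ u t′ → Answer R s t t′ u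
  escape : ⟦ t ⟧ ⟶β ⟦ u ⟧ → (SN t′ → Tame t → Tame u) → Answer R s t t′ u

module Expansion
  (R : Subst → Term → Term → Set)
  (answer : ∀ {s t t′ u} → R s t t′ → t ⟶ u → Answer R s t t′ u)
  (unTame : ∀ {s t t′} → R s t t′ → SNₛ s → SN t′ → Tame t)
  (ih : ∀ {t} → ⟦ t ⟧ ≺⁺ p → Tame t → SN t)
  where

  -- Each recursive call decreases `s` or `t′` and keeps the other. Transitive closure is used
  -- because one step of `t` may cost several of `t′`.
  expand⁺ : R s t t′ → p ↠ ⟦ t ⟧ → SNₛ s → Acc (TransClosure (flip _⟶_)) t′ → SN t
  expand⁺ {s} {t} {t′} r ps (acc hs) (acc ht) = acc λ x → go x (answer r x)
    where
    sn : SN t′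
    sn = accessible⁻ _ (acc ht)

    go : t ⟶ u → Answer R s t t′ u → SN u
    go x (done refl)    = sn
    go x (follow r′ ys) = expand⁺ r′ (ps ◅◅ ⟶-⟦⟧ x) (acc hs) (ht ys)
    go x (erased y r′)  = expand⁺ r′ (ps ◅◅ ⟶-⟦⟧ x) (hs y) (acc ht)
    -- The β-step puts `⟦ u ⟧` strictly below `p`, so the outer induction applies.
    go x (escape b k)   = ih (↠-⟶β⇒≺⁺ ps b) (k sn (unTame r (acc hs) sn))

  expand : R s t t′ → p ↠ ⟦ t ⟧ → SNₛ s → SN t′ → SN t
  expand r ps hs ht = expand⁺ r ps hs (accessible _ ht)

⟶⁺-map : {f : Term → Term} → (∀ {t t′} → t ⟶ t′ → f t ⟶ f t′) → t ⟶⁺ t′ → f t ⟶⁺ f t′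
⟶⁺-map g (single x) = single (g x)
⟶⁺-map g (x ∷ xs)   = g x ∷ ⟶⁺-map g xs

▹-answer : t ▹[ s ] t′ → t ⟶ u → Answer (λ s t t′ → t ▹[ s ] t′) s t t′ u
▹-answer App (root App)        = done refl
▹-answer App ([]ˡ (·ˡ x))      = follow App (single (·ˡ ([]ˡ x)))
▹-answer App ([]ˡ (·ʳ x))      = follow App (single (·ʳ ([]ˡ x)))
-- The new substitution `u /` is tame: the head contractum contains `u [ s ]`, so `u` normalizes.
▹-answer (App {s = s}) ([]ˡ (root (Beta {t} {u}))) =
  escape (sub-⟶β ⟦ s ⟧ₛ (β {p = ⟦ t ⟧} {q = ⟦ u ⟧}))
  λ h ((a , b) , c) → (a , b , SN-body (SN-argument h)) , c
-- Both copies of `s` must be reduced.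
▹-answer App ([]ʳ x)           = follow App (·ʳ ([]ʳ x) ∷ single (·ˡ ([]ʳ x)))
▹-answer Lambda (root Lambda)  = done refl
▹-answer Lambda ([]ˡ (ƛ⟶ x))   = follow Lambda (single (ƛ⟶ ([]ˡ x)))
▹-answer Lambda ([]ʳ x)        = follow Lambda (single (ƛ⟶ ([]ʳ (⇑⟶ x))))
▹-answer FVar (root FVar)      = done refl
▹-answer FVar (root (RVar {{n≢0}})) = ⊥-elim-irr (≢-nonZero⁻¹ 0 {{n≢0}} refl)
▹-answer FVar ([]ˡ (root ()))
▹-answer FVar ([]ʳ (/⟶ x))     = follow FVar (single x)
▹-answer RVar (root RVar)      = done refl
▹-answer (RVar {{n≢0}}) (root FVar) = ⊥-elim-irr (≢-nonZero⁻¹ 0 {{n≢0}} refl)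
▹-answer RVar ([]ˡ (root ()))
▹-answer RVar ([]ʳ (/⟶ x))     = erased (/⟶ x) RVar
▹-answer FVarLift (root FVarLift) = done refl
▹-answer FVarLift (root (RVarLift {{n≢0}})) = ⊥-elim-irr (≢-nonZero⁻¹ 0 {{n≢0}} refl)
▹-answer FVarLift ([]ˡ (root ()))
▹-answer FVarLift ([]ʳ (⇑⟶ x)) = erased x FVarLift
▹-answer RVarLift (root RVarLift) = done refl
▹-answer (RVarLift {{n≢0}}) (root FVarLift) = ⊥-elim-irr (≢-nonZero⁻¹ 0 {{n≢0}} refl)
▹-answer RVarLift ([]ˡ (root ()))
▹-answer RVarLift ([]ʳ (⇑⟶ x)) = follow RVarLift (single ([]ˡ ([]ʳ x)))
▹-answer VarShift (root VarShift) = done refl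
▹-answer VarShift ([]ˡ (root ()))
▹-answer (·ˡ ()) (root Beta)
▹-answer (·ˡ r) (·ʳ x)         = follow (·ˡ r) (single (·ʳ x))
▹-answer (·ˡ r) (·ˡ x) with ▹-answer r x
... | done refl   = done refl
... | follow r ys = follow (·ˡ r) (⟶⁺-map ·ˡ ys)
... | erased y r  = erased y (·ˡ r)
... | escape b k  = escape (appˡ b) λ h (a , c) → k (SN-function h) a , c
-- The outer substitution moves past the head step, which persists in the function part.
▹-answer ([]ˡ (·ˡ r)) (root App) = follow (·ˡ ([]ˡ r)) (single (root App))
▹-answer ([]ˡ r) ([]ʳ x)       = follow ([]ˡ r) (single ([]ʳ x))
▹-answer ([]ˡ r) ([]ˡ x) with ▹-answer r x
... | done refl   = done refl
... | follow r ys = follow ([]ˡ r) (⟶⁺-map []ˡ ys)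
... | erased y r  = erased y ([]ˡ r)
... | escape b k  = escape (sub-⟶β _ b) λ h (a , c) → k (SN-body h) a , c

▹β-answer : t ▹β t′ → t ⟶ u → Answer (λ _ → _▹β_) s t t′ u
▹β-answer Beta (root Beta)  = done refl
▹β-answer Beta (·ˡ (ƛ⟶ x))  = follow Beta (single ([]ˡ x))
▹β-answer Beta (·ʳ x)       = follow Beta (single ([]ʳ (/⟶ x)))
▹β-answer (·ˡ ()) (root Beta)
▹β-answer (·ˡ r) (·ʳ x)     = follow (·ˡ r) (single (·ʳ x))
▹β-answer {s = s} (·ˡ r) (·ˡ x) with ▹β-answer {s = s} r x
... | done refl   = done refl
... | follow r ys = follow (·ˡ r) (⟶⁺-map ·ˡ ys)
... | erased y r  = erased y (·ˡ r)
... | escape b k  = escape (appˡ b) λ h (a , c) → k (SN-function h) a , c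

-- The contracted argument becomes a substitution. It normalizes by induction, as its translation is
-- a proper subterm.
▹β-Tame : t ▹β t′ → (∀ {u} → ⟦ u ⟧ ≺⁺ ⟦ t ⟧ → Tame u → SN u) → Tame t → Tame t′
▹β-Tame Beta   ih (a , b) = a , b , ih (single appʳ) b
▹β-Tame (·ˡ h) ih (a , b) = ▹β-Tame h (λ lt → ih (lt ∷ʳ appˡ)) a , b

module _ (ih : ∀ {t} → ⟦ t ⟧ ≺⁺ p → Tame t → SN t) where

  SN-step : ⟦ t ⟧ ≡ p → Tame t → Acc _<_ (weight t) → SN t
  SN-step {t} e tm (acc hw) with progress t
  SN-step refl tm (acc hw) | υ-step r with tm′ , hs ← ▹-Tame r tm =
    Expansion.expand _ ▹-answer ▹-unTame ih r ε hs
      (SN-step (sym (▹-⟦⟧ r)) tm′ (hw (▹-weight r)))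
  SN-step refl tm _ | β-step r =
    -- `↑` is a default index: a β head step erases no substitution.
    Expansion.expand (λ _ → _▹β_) ▹β-answer (λ r _ → ▹β-unTame r) ih {s = ↑} r ε (acc λ ())
      (ih (single (β (▹β-⟦⟧ r))) (▹β-Tame r ih tm))
  SN-step refl tm _ | abs t             = SN-ƛ (ih (single lam) tm)
  SN-step refl tm _ | neutral (var n)   = acc λ where (root ())
  SN-step refl (tm , um) _ | neutral (m · u) =
    SN-· m (ih (single appˡ) tm) (ih (single appʳ) um)

Tame⇒SN : Acc _≺⁺_ p → ⟦ t ⟧ ≡ p → Tame t → SN t
Tame⇒SN (acc h) e tm =
  SN-step (λ lt um → Tame⇒SN (h lt) refl um) e tm (<-wellFounded _)

mutual

  -- Tameness calls for normalization only of terms under `/`, whose derivations are smaller, so the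
  -- mutual recursion terminates.
  ⊢⇒SN : ∀ {a} {Atom : Set a} {Γ : Env Atom} {A} → Γ ⊢ t ∶ A → SN t
  ⊢⇒SN ⊢t = Tame⇒SN (accessible _ (SNβ⇒≺-acc (⊢⇒SNβ ⊢t))) refl (⊢⇒Tame ⊢t)

  ⊢⇒Tame : ∀ {a} {Atom : Set a} {Γ : Env Atom} {A} → Γ ⊢ t ∶ A → Tame t
  ⊢⇒Tame ⊢var       = tt
  ⊢⇒Tame (⊢[] ⊢s ⊢t) = ⊢⇒Tame ⊢t , ⊢⇒Tameₛ ⊢s
  ⊢⇒Tame (⊢· ⊢t ⊢u)  = ⊢⇒Tame ⊢t , ⊢⇒Tame ⊢u
  ⊢⇒Tame (⊢ƛ ⊢t)     = ⊢⇒Tame ⊢t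

  ⊢⇒Tameₛ : ∀ {a} {Atom : Set a} {Γ Δ : Env Atom} → Γ ⊢ s ▷ Δ → Tameₛ s
  ⊢⇒Tameₛ (⊢/ ⊢t) = ⊢⇒Tame ⊢t , ⊢⇒SN ⊢t
  ⊢⇒Tameₛ ⊢↑      = tt
  ⊢⇒Tameₛ (⊢⇑ ⊢s) = ⊢⇒Tameₛ ⊢s

corollary4p17 : ∀ {a : Level} {Atom : Set a} {Γ : Env Atom} {t : Term} {A : Type Atom} →
    Γ ⊢ t ∶ A →
    ¬ (∃[ f ] InfiniteDescendingSequenceFrom (flip _⟶_) f t)
corollary4p17 ⊢t (f , f0≡t , steps) =
  -- Each term occurring in the sequence has a reduct occurring in it.
  descent∧acc⇒unsatisfiable {P = λ u → ∃[ n ] f n ≡ u}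
    (λ { (n , refl) → f (suc n) , steps n , suc n , refl }) (⊢⇒SN ⊢t) (0 , f0≡t)
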